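{- For every odd prime $p$, the Wagstaff number with exponent $p$, $$\zeta(p,2,1)=\frac{2^p+1}{3},$$ is primover base $2$.
   Context: $\zeta(n,k,h)$ is the product, counted with multiplicity, of the primitive prime divisors of $k^n+h^n$, i.e. of the primes dividing $k^n+h^n$ and dividing no $k^u+h^u$ with $1\le u<n$. For $n$ coprime to $k$, let $O_n(k)$ be the multiplicative order of $k$ modulo $n$ and let $r_k(n)$ be the number of distinct cyclotomic cosets of $k$ modulo $n$ on the nonzero residues (orbits of multiplication by $k$ on $\{1,\dots,n-1\}$ modulo $n$). A composite number $n$ coprime to $k$ is overpseudoprime base $k$ if $n=r_k(n)O_n(k)+1$; equivalently, $O_d(k)=O_n(k)$ for every divisor $d>1$ of $n$. A number is primover base $k$ if it is prime or a composite overpseudoprime base $k$.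
   Formalization: The equality ζ(p,2,1) = (2^p+1)/3 is stated only for p ≠ 3, since it fails at p = 3 (3 divides 2^1+1, so ζ(3,2,1) = 1 ≠ 3); that (2^p+1)/3 is primover base 2 is stated for every odd prime p. -}

module Defs where

open import Data.Fin using (Fin; toℕ; fromℕ<)
open import Data.Fin.Properties as Fin using (pigeonhole; toℕ-fromℕ<; toℕ-injective; toℕ<n)
open import Data.List using (List; length; filter; deduplicate; allFin)
open import Data.Nat
open import Data.Nat.Coprimality using (Coprime)
open import Data.Nat.Divisibility using (_∣_; _∣?_)
open import Data.Nat.DivMod using (_%_; _mod_; m%n%n≡m%n; m%n<n; %-distribˡ-*)
open import Data.Nat.Induction using (<-rec)
open import Data.Nat.ListAction using (product)
open import Data.Nat.Primality using (Prime; Composite; prime?)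
open import Data.Nat.Primality.Factorisation using (factorise; factors)
open import Data.Nat.Properties
open import Data.Product using (∃; ∃-syntax; _×_; _,_)
open import Data.Sum using (_⊎_)
open import Relation.Binary using (Decidable)
open import Relation.Binary.PropositionalEquality
open import Relation.Nullary using (¬_; Dec; yes; no)
open import Relation.Nullary.Decidable using (map′; ¬?; _×-dec_; _→-dec_)

Primitive : (n k h q : ℕ) → Set
Primitive n k h q =
  Prime q × q ∣ k ^ n + h ^ n × (∀ {u} → u < n → 1 ≤ u → ¬ q ∣ k ^ u + h ^ u)

primitive? : ∀ n k h q → Dec (Primitive n k h q)
primitive? n k h q =
  prime? q ×-dec q ∣? k ^ n + h ^ n
    ×-dec allUpTo? (λ u → 1 ≤? u →-dec ¬? (q ∣? k ^ u + h ^ u)) n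

k^n+h^n≢0 : ∀ n k h .{{_ : NonZero k}} → NonZero (k ^ n + h ^ n)
k^n+h^n≢0 n k h = >-nonZero (≤-trans (m^n>0 k n) (m≤m+n (k ^ n) (h ^ n)))

ζ : (n k h : ℕ) .{{_ : NonZero k}} → ℕ
ζ n k h =
  product (filter (primitive? n k h) (factors (factorise (k ^ n + h ^ n) {{k^n+h^n≢0 n k h}})))

-- 9 = 3², but 3 already divides 2¹ + 1, so ζ(3,2,1) is the empty product
-- and not (2³ + 1)/3 = 3.
ζ[3,2,1]≡1 : ζ 3 2 1 ≡ 1
ζ[3,2,1]≡1 = refl

-- o = O_n(k).  The congruence k ^ i ≡ 1 (mod n) is written n ∣ ∣ k ^ i - 1 ∣.
IsMultiplicativeOrder : (k n o : ℕ) → Set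
IsMultiplicativeOrder k n o =
  1 ≤ o × n ∣ ∣ k ^ o - 1 ∣ × (∀ i → 1 ≤ i → n ∣ ∣ k ^ i - 1 ∣ → o ≤ i)

infixr 7 _⊙_

-- Fin n stands for the residues modulo n.
_⊙_ : ∀ {n} → ℕ → Fin n → Fin n
_⊙_ {suc n} k a = (k * toℕ a) mod suc n

-- An equivalence relation when k is coprime to n.
SameCoset : ∀ {n} → ℕ → Fin n → Fin n → Set
SameCoset k a b = ∃[ i ] (k ^ i) ⊙ a ≡ b

⊙-assoc : ∀ {n} k l (a : Fin n) → (k * l) ⊙ a ≡ k ⊙ l ⊙ a
⊙-assoc {suc n} k l a = toℕ-injective (begin
  toℕ ((k * l) ⊙ a)                            ≡⟨ toℕ-fromℕ< (m%n<n (k * l * toℕ a) N) ⟩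
  (k * l * toℕ a) % N                          ≡⟨ cong (_% N) (*-assoc k l (toℕ a)) ⟩
  (k * (l * toℕ a)) % N                        ≡⟨ %-distribˡ-* k (l * toℕ a) N ⟩
  ((k % N) * ((l * toℕ a) % N)) % N            ≡⟨ cong (λ x → ((k % N) * x) % N) (m%n%n≡m%n (l * toℕ a) N) ⟨
  ((k % N) * ((l * toℕ a) % N % N)) % N        ≡⟨ %-distribˡ-* k ((l * toℕ a) % N) N ⟨
  (k * ((l * toℕ a) % N)) % N                  ≡⟨ cong (λ x → (k * x) % N) (toℕ-fromℕ< (m%n<n (l * toℕ a) N)) ⟨
  (k * toℕ (l ⊙ a)) % N                        ≡⟨ toℕ-fromℕ< (m%n<n (k * toℕ (l ⊙ a)) N) ⟨
  toℕ (k ⊙ l ⊙ a)                              ∎)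
  where
  open ≡-Reasoning
  N = suc n

⊙-^-+ : ∀ {n} k i j (a : Fin n) → (k ^ (i + j)) ⊙ a ≡ (k ^ i) ⊙ (k ^ j) ⊙ a
⊙-^-+ k i j a =
  trans (cong (_⊙ a) (^-distribˡ-+-* k i j)) (⊙-assoc (k ^ i) (k ^ j) a)

-- By the pigeonhole principle, a residue in the orbit of a is reached by an
-- exponent below n; this makes SameCoset decidable.
boundedExponent : ∀ {n} k (a b : Fin n) → SameCoset k a b →
                  ∃[ i ] i < n × (k ^ i) ⊙ a ≡ b
boundedExponent {n} k a b (i , eq) = <-rec P step i eq
  where
  P : ℕ → Set
  P i = (k ^ i) ⊙ a ≡ b → ∃[ j ] j < n × (k ^ j) ⊙ a ≡ b

  step : ∀ i → (∀ {j} → j < i → P j) → P i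
  step i rec eq with i <? n
  ... | yes i<n = i , i<n , eq
  ... | no  i≮n
    with x , y , x<y , same ← pigeonhole (n<1+n n) (λ j → (k ^ toℕ j) ⊙ a)
    = rec shorter (begin
        (k ^ (d + toℕ x)) ⊙ a         ≡⟨ ⊙-^-+ k d (toℕ x) a ⟩
        (k ^ d) ⊙ (k ^ toℕ x) ⊙ a     ≡⟨ cong ((k ^ d) ⊙_) same ⟩
        (k ^ d) ⊙ (k ^ toℕ y) ⊙ a     ≡⟨ ⊙-^-+ k d (toℕ y) a ⟨
        (k ^ (d + toℕ y)) ⊙ a         ≡⟨ cong (λ e → (k ^ e) ⊙ a) (m∸n+n≡m y≤i) ⟩
        (k ^ i) ⊙ a                   ≡⟨ eq ⟩
        b                             ∎)
    where
    open ≡-Reasoning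
    d = i ∸ toℕ y

    y≤i : toℕ y ≤ i
    y≤i = ≤-trans (s≤s⁻¹ (toℕ<n y)) (≮⇒≥ i≮n)

    shorter : d + toℕ x < i
    shorter = subst (d + toℕ x <_) (m∸n+n≡m y≤i) (+-monoʳ-< d x<y)

sameCoset? : ∀ {n} k → Decidable (SameCoset {n} k)
sameCoset? {n} k a b =
  map′ (λ (i , _ , eq) → i , eq) (boundedExponent k a b)
       (anyUpTo? (λ i → (k ^ i) ⊙ a Fin.≟ b) n)

nonzeroResidues : ∀ n → List (Fin n)
nonzeroResidues n = filter (λ a → ¬? (toℕ a ≟ 0)) (allFin n)

-- r_k(n), meaningful for k coprime to n: deduplicate keeps one representative
-- of each coset.
cosetCount : (k n : ℕ) → ℕ
cosetCount k n = length (deduplicate (sameCoset? k) (nonzeroResidues n))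

Overpseudoprime : (k n : ℕ) → Set
Overpseudoprime k n =
  Composite n × Coprime n k ×
  ∃[ o ] IsMultiplicativeOrder k n o × n ≡ cosetCount k n * o + 1

Primover : (k n : ℕ) → Set
Primover k n = Prime n ⊎ Overpseudoprime k n

{-# OPTIONS --safe #-}
-- If d divides 2^p + 1 but not 3, then 2 has order exactly 2p modulo d: from
-- 2^(2p) ≡ 1 and 2^i ≡ 1, the case p ∤ i would give 2² ≡ 1, and i an odd multiple
-- of p would give 2^p ≡ 1, hence d ∣ 2.  Taking d = 9 shows that 3 divides
-- 2^p + 1 exactly once when p ≠ 3; taking d prime shows that every prime factor
-- but 3 is primitive; taking for d all divisors > 1 of (2^p + 1)/3 shows that ⟨2⟩
-- acts freely on the nonzero residues, so that all cosets have 2p elements.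
module Submission where

open import Defs
open import Data.Nat using (ℕ; _+_; _^_; _/_)
open import Data.Nat.Divisibility using (_∣_)
open import Data.Nat.Primality using (Prime)
open import Data.Product using (_×_)
open import Relation.Binary.PropositionalEquality using (_≡_; _≢_)
open import Relation.Nullary using (¬_)

open import Data.Fin as Fin using (Fin; toℕ)
open import Data.Fin.Properties using (toℕ-fromℕ<; toℕ-injective; toℕ<n)
open import Data.List using (List; []; _∷_; length; map; concat; filter; deduplicate; applyUpTo; tabulate; allFin)
open import Data.List.Membership.Propositional using (_∈_; find; lose)
open import Data.List.Membership.Propositional.Properties
open import Data.List.Membership.Propositional.Properties.WithK using (unique∧set⇒bag)
open import Data.List.Properties using (length-++; length-tabulate; length-applyUpTo; length-map; filter-all; filter-reject)
open import Data.List.Relation.Binary.BagAndSetEquality using (∼bag⇒↭)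
open import Data.List.Relation.Binary.Disjoint.Propositional using (Disjoint)
open import Data.List.Relation.Binary.Permutation.Propositional using (_↭_)
open import Data.List.Relation.Binary.Permutation.Propositional.Properties using (↭-length; filter-↭)
open import Data.List.Relation.Unary.All as All using (All; []; _∷_)
import Data.List.Relation.Unary.All.Properties as All
open import Data.List.Relation.Unary.AllPairs as AllPairs using ()
import Data.List.Relation.Unary.AllPairs.Properties as AllPairs
import Data.List.Relation.Unary.Any.Properties as Any
open import Data.List.Relation.Unary.Unique.DecSetoid.Properties using (deduplicate-!)
open import Data.List.Relation.Unary.Unique.Propositional using (Unique)
import Data.List.Relation.Unary.Unique.Propositional.Properties as Unique
open import Data.Nat hiding (ℕ; _+_; _^_; _/_)
open import Data.Nat.Coprimality as Coprimality using (Coprime; coprime-Bézout; coprime-divisor; coprime-/gcd)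
open import Data.Nat.Divisibility hiding (_∣_)
open import Data.Nat.DivMod hiding (_/_)
open import Data.Nat.GCD using (gcd; gcd[m,n]∣m; gcd[m,n]∣n; gcd[m,n]≢0; module Bézout)
open import Data.Nat.ListAction using (product)
open import Data.Nat.ListAction.Properties using (∈⇒∣product; product-↭)
open import Data.Nat.Primality hiding (Prime)
open import Data.Nat.Primality.Factorisation
open import Data.Nat.Properties
open import Data.Nat.Tactic.RingSolver using (solve-∀)
open import Data.Product using (_,_; proj₂)
open import Data.Sum using (inj₁; inj₂; [_,_])
open import Function using (_∘_; mk⇔)
open import Relation.Binary using (DecSetoid)
open import Relation.Binary.PropositionalEquality using (refl; sym; trans; cong; cong₂; subst; subst₂; module ≡-Reasoning)
open import Relation.Nullary using (yes; no; contradiction)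
open import Relation.Nullary.Decidable using (from-yes; from-no; ¬?)
open import Relation.Unary using (Pred; Decidable)

open PrimeFactorisation using (isFactorisation; factorsPrime)

-- Exponents i with k^i ≡ 1 modulo d.

suc∣n-1∣≡n : ∀ n .{{_ : NonZero n}} → suc ∣ n - 1 ∣ ≡ n
suc∣n-1∣≡n (suc n) = cong suc (∣-∣-identityʳ n)

∣m*n-1∣ : ∀ m n .{{_ : NonZero m}} .{{_ : NonZero n}} →
          ∣ m * n - 1 ∣ ≡ m * ∣ n - 1 ∣ + ∣ m - 1 ∣
∣m*n-1∣ m@(suc m′) n@(suc n′) = begin
  ∣ n′ + m′ * n - 0 ∣             ≡⟨ ∣-∣-identityʳ _ ⟩
  n′ + m′ * n                     ≡⟨ expand m′ n′ ⟩
  m * n′ + m′                     ≡⟨ cong₂ (λ x y → m * x + y) (∣-∣-identityʳ n′) (∣-∣-identityʳ m′) ⟨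
  m * ∣ n′ - 0 ∣ + ∣ m′ - 0 ∣     ∎
  where
  open ≡-Reasoning
  expand : ∀ m n → n + m * suc n ≡ suc m * n + m
  expand = solve-∀

prime∧∤⇒coprime : ∀ {p n} → Prime p → ¬ p ∣ n → Coprime n p
prime∧∤⇒coprime prime[p] p∤n (d∣n , d∣p) with prime⇒irreducible prime[p] d∣p
... | inj₁ d≡1  = d≡1
... | inj₂ refl = contradiction d∣n p∤n

module UnitPowers (k d : ℕ) .{{_ : NonZero k}} where

  UnitPower : ℕ → Set
  UnitPower i = d ∣ ∣ k ^ i - 1 ∣

  private
    ∣k^[i+j]-1∣ : ∀ i j → ∣ k ^ (i + j) - 1 ∣ ≡ k ^ i * ∣ k ^ j - 1 ∣ + ∣ k ^ i - 1 ∣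
    ∣k^[i+j]-1∣ i j = trans (cong ∣_- 1 ∣ (^-distribˡ-+-* k i j))
      (∣m*n-1∣ (k ^ i) (k ^ j) {{m^n≢0 k i}} {{m^n≢0 k j}})

  unitPower-+ : ∀ i j → UnitPower i → UnitPower j → UnitPower (i + j)
  unitPower-+ i j u v = subst (d ∣_) (sym (∣k^[i+j]-1∣ i j)) (∣m∣n⇒∣m+n (∣n⇒∣m*n (k ^ i) v) u)

  -- In the expansion of k^(i+j) - 1 the summand k^i (k^j - 1) is divisible by d, which leaves k^i -
  -- 1. Exponents can thus be subtracted without inverting a power of k.
  unitPower-cancelʳ : ∀ i j → UnitPower j → UnitPower (i + j) → UnitPower i
  unitPower-cancelʳ i j v w = ∣m+n∣m⇒∣n (subst (d ∣_) (∣k^[i+j]-1∣ i j) w) (∣n⇒∣m*n (k ^ i) v)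

  unitPower-* : ∀ m i → UnitPower i → UnitPower (m * i)
  unitPower-* zero    i u = d ∣0
  unitPower-* (suc m) i u = unitPower-+ i (m * i) u (unitPower-* m i u)

  -- By Bézout, c is the difference of a multiple of m * c and a multiple of n * c. The coefficients
  -- are natural numbers, so either multiple can be the larger one, whence the two symmetric cases.
  unitPower-coprime : ∀ {m n} c → Coprime m n →
                      UnitPower (m * c) → UnitPower (n * c) → UnitPower c
  unitPower-coprime {m} {n} c coprime u v with coprime-Bézout coprime
  ... | Bézout.+- x y eq = unitPower-cancelʳ c (y * (n * c)) (unitPower-* y (n * c) v)
        (subst UnitPower eq′ (unitPower-* x (m * c) u))
      where
      open ≡-Reasoning
      eq′ : x * (m * c) ≡ c + y * (n * c)
      eq′ = begin
        x * (m * c)        ≡⟨ *-assoc x m c ⟨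
        x * m * c          ≡⟨ cong (_* c) eq ⟨
        c + y * n * c      ≡⟨ cong (c +_) (*-assoc y n c) ⟩
        c + y * (n * c)    ∎
  ... | Bézout.-+ x y eq = unitPower-cancelʳ c (x * (m * c)) (unitPower-* x (m * c) u)
        (subst UnitPower eq′ (unitPower-* y (n * c) v))
      where
      open ≡-Reasoning
      eq′ : y * (n * c) ≡ c + x * (m * c)
      eq′ = begin
        y * (n * c)        ≡⟨ *-assoc y n c ⟨
        y * n * c          ≡⟨ cong (_* c) eq ⟨
        c + x * m * c      ≡⟨ cong (c +_) (*-assoc x m c) ⟩
        c + x * (m * c)    ∎

  -- Difference of squares: k^(2i) - 1 = (k^i + 1)(k^i - 1).
  ∣k^i+1⇒unitPower : ∀ i → d ∣ k ^ i + 1 → UnitPower (i + i)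
  ∣k^i+1⇒unitPower i d∣ = subst (d ∣_) (sym (trans (∣k^[i+j]-1∣ i i) (factor (k ^ i) ∣ k ^ i - 1 ∣)))
    (∣m⇒∣m*n ∣ k ^ i - 1 ∣ d∣)
    where
    factor : ∀ m x → m * x + x ≡ (m + 1) * x
    factor = solve-∀

open UnitPowers

-- Counting in lists, and fixed points of multiplication on residues.

length-concat : ∀ {a} {A : Set a} {xss : List (List A)} {m} →
                All (λ xs → length xs ≡ m) xss → length (concat xss) ≡ length xss * m
length-concat []                      = refl
length-concat {xss = xs ∷ _} (l ∷ ls) = trans (length-++ xs) (cong₂ _+_ l (length-concat ls))

unique∧set⇒↭ : ∀ {a} {A : Set a} {xs ys : List A} → Unique xs → Unique ys →
               (∀ {x} → x ∈ xs → x ∈ ys) → (∀ {x} → x ∈ ys → x ∈ xs) → xs ↭ ys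
unique∧set⇒↭ xs! ys! xs⊆ys ys⊆xs = ∼bag⇒↭ (unique∧set⇒bag xs! ys! (mk⇔ xs⊆ys ys⊆xs))

toℕ-⊙ : ∀ {n} k (a : Fin (suc n)) → toℕ (k ⊙ a) ≡ (k * toℕ a) % suc n
toℕ-⊙ {n} k a = toℕ-fromℕ< (m%n<n (k * toℕ a) (suc n))

private
  m*a≡a+∣m-1∣*a : ∀ m a .{{_ : NonZero m}} → m * a ≡ a + ∣ m - 1 ∣ * a
  m*a≡a+∣m-1∣*a m a = cong (_* a) (sym (suc∣n-1∣≡n m))

∣⇒⊙-fixed : ∀ {n} m .{{_ : NonZero m}} (a : Fin n) → n ∣ ∣ m - 1 ∣ → m ⊙ a ≡ a
∣⇒⊙-fixed {n@(suc _)} m a n∣ = toℕ-injective (begin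
  toℕ (m ⊙ a)                            ≡⟨ toℕ-⊙ m a ⟩
  (m * toℕ a) % n                        ≡⟨ cong (_% n) (m*a≡a+∣m-1∣*a m (toℕ a)) ⟩
  (toℕ a + ∣ m - 1 ∣ * toℕ a) % n        ≡⟨ %-remove-+ʳ (toℕ a) (∣m⇒∣m*n (toℕ a) n∣) ⟩
  toℕ a % n                              ≡⟨ m<n⇒m%n≡m (toℕ<n a) ⟩
  toℕ a                                  ∎)
  where open ≡-Reasoning

-- Division of m * a by n leaves the remainder a, so in m * a = a + (m - 1) * a the second summand
-- is the quotient times n.
⊙-fixed⇒∣ : ∀ {n} m .{{_ : NonZero m}} (a : Fin n) → m ⊙ a ≡ a → n ∣ ∣ m - 1 ∣ * toℕ a
⊙-fixed⇒∣ {n@(suc _)} m a fixed = divides q (+-cancelˡ-≡ (toℕ a) _ _ (begin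
  toℕ a + ∣ m - 1 ∣ * toℕ a    ≡⟨ m*a≡a+∣m-1∣*a m (toℕ a) ⟨
  m * toℕ a                    ≡⟨ m≡m%n+[m/n]*n (m * toℕ a) n ⟩
  (m * toℕ a) % n + q * n      ≡⟨ cong (_+ q * n) (trans (sym (toℕ-⊙ m a)) (cong toℕ fixed)) ⟩
  toℕ a + q * n                ∎))
  where
  open ≡-Reasoning
  q = (m * toℕ a) / n

⊙-zero : ∀ {n} m (a : Fin n) → toℕ a ≡ 0 → toℕ (m ⊙ a) ≡ 0
⊙-zero {suc n} m Fin.zero refl = trans (toℕ-⊙ {n} m Fin.zero) (cong (_% suc n) (*-zeroʳ m))

length-nonzeroResidues : ∀ n → length (nonzeroResidues (suc n)) ≡ n
length-nonzeroResidues n = begin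
  length (nonzeroResidues (suc n))                            ≡⟨ cong length (filter-reject nonzero? {Fin.zero} {tabulate Fin.suc} (λ 0≢0 → 0≢0 refl)) ⟩
  length (filter nonzero? (tabulate (Fin.suc {n})))           ≡⟨ cong length (filter-all nonzero? (All.tabulate⁺ {f = Fin.suc {n}} (λ _ ()))) ⟩
  length (tabulate (Fin.suc {n}))                             ≡⟨ length-tabulate Fin.suc ⟩
  n                                                           ∎
  where
  open ≡-Reasoning
  nonzero? : Decidable (λ (a : Fin (suc n)) → toℕ a ≢ 0)
  nonzero? a = ¬? (toℕ a ≟ 0)

-- Coset count when k has the same order modulo every divisor of n except 1.

module CosetsOfEqualOrder
  (k n o : ℕ) .{{_ : NonZero k}} .{{_ : NonZero n}} .{{_ : NonZero o}}
  (n∣k^o-1 : UnitPower k n o)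
  (order : ∀ {d} → d ∣ n → d ≢ 1 → ∀ i → UnitPower k d i → o ∣ i) where

  private
    _^⊙_ : ℕ → Fin n → Fin n
    i ^⊙ a = (k ^ i) ⊙ a

    unitPower⇒^⊙-fixed : ∀ i → UnitPower k n i → ∀ a → i ^⊙ a ≡ a
    unitPower⇒^⊙-fixed i u a = ∣⇒⊙-fixed (k ^ i) {{m^n≢0 k i}} a u

    -- d = n / gcd n a reduces k^e a ≡ a (mod n) to k^e ≡ 1 (mod d).
    ^⊙-fixed⇒o∣ : ∀ {a} → toℕ a ≢ 0 → ∀ e → e ^⊙ a ≡ a → o ∣ e
    ^⊙-fixed⇒o∣ {a} a≢0 e fixed =
      order d∣n d≢1 e (coprime-divisor (coprime-/gcd n (toℕ a)) d∣a′*x)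
      where
      instance
        g≢0 : NonZero (gcd n (toℕ a))
        g≢0 = ≢-nonZero (gcd[m,n]≢0 n (toℕ a) (inj₁ (≢-nonZero⁻¹ n)))
        a-nonZero : NonZero (toℕ a)
        a-nonZero = ≢-nonZero a≢0
      g = gcd n (toℕ a)
      x = ∣ k ^ e - 1 ∣
      d = n / g
      a′ = toℕ a / g

      d*g≡n : d * g ≡ n
      d*g≡n = m/n*n≡m (gcd[m,n]∣m n (toℕ a))

      a′*g≡a : a′ * g ≡ toℕ a
      a′*g≡a = m/n*n≡m (gcd[m,n]∣n n (toℕ a))

      d∣n : d ∣ n
      d∣n = subst (d ∣_) d*g≡n (m∣m*n g)

      -- Otherwise the gcd would be n itself, and n would divide the nonzero residue a, which is
      -- below n.
      d≢1 : d ≢ 1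
      d≢1 d≡1 = <⇒≱ (toℕ<n a) (∣⇒≤ (subst (_∣ toℕ a) g≡n (gcd[m,n]∣n n (toℕ a))))
        where
        g≡n : g ≡ n
        g≡n = trans (sym (*-identityˡ g)) (trans (cong (_* g) (sym d≡1)) d*g≡n)

      d∣a′*x : d ∣ a′ * x
      d∣a′*x = *-cancelʳ-∣ g (subst₂ _∣_ (sym d*g≡n) eq (⊙-fixed⇒∣ (k ^ e) {{m^n≢0 k e}} a fixed))
        where
        open ≡-Reasoning
        swap : ∀ x a g → x * (a * g) ≡ a * x * g
        swap = solve-∀
        eq : x * toℕ a ≡ a′ * x * g
        eq = trans (cong (x *_) (sym a′*g≡a)) (swap x a′ g)

    orbit : Fin n → List (Fin n)
    orbit a = applyUpTo (_^⊙ a) o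

    -- The powers of k act freely. If k^i a = k^j a with i < j < o, applying k^(o - j) turns the
    -- right side into k^o a = a, so a is fixed by an exponent strictly between 0 and o, which o
    -- cannot divide.
    orbit-unique : ∀ {a} → toℕ a ≢ 0 → Unique (orbit a)
    orbit-unique {a} a≢0 = Unique.applyUpTo⁺₁ (_^⊙ a) o distinct
      where
      distinct : ∀ {i j} → i < j → j < o → i ^⊙ a ≢ j ^⊙ a
      distinct {i} {j} i<j j<o same = <⇒≱ e<o (∣⇒≤ (^⊙-fixed⇒o∣ a≢0 e (begin
        e ^⊙ a                    ≡⟨ ⊙-^-+ k (o ∸ j) i a ⟩
        (o ∸ j) ^⊙ (i ^⊙ a)       ≡⟨ cong ((o ∸ j) ^⊙_) same ⟩
        (o ∸ j) ^⊙ (j ^⊙ a)       ≡⟨ ⊙-^-+ k (o ∸ j) j a ⟨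
        (o ∸ j + j) ^⊙ a          ≡⟨ cong (_^⊙ a) (m∸n+n≡m (<⇒≤ j<o)) ⟩
        o ^⊙ a                    ≡⟨ unitPower⇒^⊙-fixed o n∣k^o-1 a ⟩
        a                         ∎)))
        where
        open ≡-Reasoning
        e = o ∸ j + i
        e<o : e < o
        e<o = subst (e <_) (m∸n+n≡m (<⇒≤ j<o)) (+-monoʳ-< (o ∸ j) i<j)
        -- `∣⇒≤` needs e to be positive, which holds because o - j already is.
        instance _ = >-nonZero (≤-trans (m<n⇒0<n∸m j<o) (m≤m+n (o ∸ j) i))

    _∼_ : Fin n → Fin n → Set
    _∼_ = SameCoset k

    ∼-refl : ∀ {a} → a ∼ a
    ∼-refl {a} = 0 , unitPower⇒^⊙-fixed 0 (n ∣0) a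

    -- The inverse of k^i is k^((o - 1) i), because the two exponents add up to o * i.
    ∼-sym : ∀ {a b} → a ∼ b → b ∼ a
    ∼-sym {a} (i , refl) = pred o * i , (begin
      (pred o * i) ^⊙ (i ^⊙ a)   ≡⟨ ⊙-^-+ k (pred o * i) i a ⟨
      (pred o * i + i) ^⊙ a      ≡⟨ cong (_^⊙ a) (trans (+-comm (pred o * i) i) (cong (_* i) (suc-pred o))) ⟩
      (o * i) ^⊙ a               ≡⟨ cong (_^⊙ a) (*-comm o i) ⟩
      (i * o) ^⊙ a               ≡⟨ unitPower⇒^⊙-fixed (i * o) (unitPower-* k n i o n∣k^o-1) a ⟩
      a                          ∎)
      where open ≡-Reasoning

    ∼-trans : ∀ {a b c} → a ∼ b → b ∼ c → a ∼ c
    ∼-trans {a} (i , refl) (j , refl) = j + i , ⊙-^-+ k j i a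

    -- The form in which `deduplicate-!` accepts the relation, to conclude that distinct
    -- representatives are inequivalent.
    ∼-decSetoid : DecSetoid _ _
    ∼-decSetoid = record
      { _≈_ = _∼_
      ; isDecEquivalence = record
        { isEquivalence = record { refl = ∼-refl ; sym = ∼-sym ; trans = ∼-trans }
        ; _≟_           = sameCoset? k
        }
      }

    ∼-nonzero : ∀ {a b} → a ∼ b → toℕ a ≢ 0 → toℕ b ≢ 0
    ∼-nonzero {b = b} a∼b a≢0 b≡0 with j , refl ← ∼-sym a∼b = a≢0 (⊙-zero (k ^ j) b b≡0)

    -- The exponent can be reduced modulo o, since exponents that are multiples of o act trivially.
    ∼⇒∈orbit : ∀ {a b} → a ∼ b → b ∈ orbit a
    ∼⇒∈orbit {a} (i , refl) = subst (_∈ orbit a) eq (∈-applyUpTo⁺ (_^⊙ a) (m%n<n i o))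
      where
      open ≡-Reasoning
      q = i / o * o
      eq : (i % o) ^⊙ a ≡ i ^⊙ a
      eq = begin
        (i % o) ^⊙ a             ≡⟨ cong ((i % o) ^⊙_) (unitPower⇒^⊙-fixed q (unitPower-* k n (i / o) o n∣k^o-1) a) ⟨
        (i % o) ^⊙ (q ^⊙ a)      ≡⟨ ⊙-^-+ k (i % o) q a ⟨
        (i % o + q) ^⊙ a         ≡⟨ cong (_^⊙ a) (m≡m%n+[m/n]*n i o) ⟨
        i ^⊙ a                   ∎

    ∈orbit⇒∼ : ∀ {a b} → b ∈ orbit a → a ∼ b
    ∈orbit⇒∼ {a} b∈ with i , _ , refl ← ∈-applyUpTo⁻ (_^⊙ a) b∈ = i , refl

    residues reps : List (Fin n)
    residues = nonzeroResidues n
    reps = deduplicate (sameCoset? k) residues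

    orbits : List (List (Fin n))
    orbits = map orbit reps

    ∈residues⁺ : ∀ {a} → toℕ a ≢ 0 → a ∈ residues
    ∈residues⁺ {a} = ∈-filter⁺ (λ a → ¬? (toℕ a ≟ 0)) (∈-allFin a)

    ∈residues⁻ : ∀ {a} → a ∈ residues → toℕ a ≢ 0
    ∈residues⁻ a∈ = proj₂ (∈-filter⁻ (λ a → ¬? (toℕ a ≟ 0)) {xs = allFin n} a∈)

    ∈reps⇒nonzero : ∀ {a} → a ∈ reps → toℕ a ≢ 0
    ∈reps⇒nonzero a∈ = ∈residues⁻ (∈-deduplicate⁻ (sameCoset? k) residues a∈)

    -- Within one orbit this is freeness; between two orbits, a common element would make their
    -- representatives equivalent.
    orbits-unique : Unique (concat orbits)
    orbits-unique = Unique.concat⁺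
      (All.map⁺ (All.tabulate (λ a∈ → orbit-unique (∈reps⇒nonzero a∈))))
      (AllPairs.map⁺ (AllPairs.map disjoint (deduplicate-! ∼-decSetoid residues)))
      where
      disjoint : ∀ {a b} → ¬ a ∼ b → Disjoint (orbit a) (orbit b)
      disjoint a≁b (c∈a , c∈b) = a≁b (∼-trans (∈orbit⇒∼ c∈a) (∼-sym (∈orbit⇒∼ c∈b)))

    residues⊆orbits : ∀ {b} → b ∈ residues → b ∈ concat orbits
    residues⊆orbits {b} b∈
      -- The residue b is equivalent to itself, and being equivalent to b is invariant under the
      -- relation, so some representative that survives deduplication is equivalent to b.
      with a , a∈ , b∼a ← find (Any.deduplicate⁺ (sameCoset? k) {P = b ∼_}
                                 (λ x∼y b∼y → ∼-trans b∼y (∼-sym x∼y)) (lose b∈ ∼-refl))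
      = ∈-concat⁺′ (∼⇒∈orbit (∼-sym b∼a)) (∈-map⁺ orbit a∈)

    orbits⊆residues : ∀ {b} → b ∈ concat orbits → b ∈ residues
    orbits⊆residues b∈
      with _ , b∈orbit , orbit∈ ← ∈-concat⁻′ orbits b∈
      with a , a∈ , refl ← ∈-map⁻ orbit orbit∈
      = ∈residues⁺ (∼-nonzero (∈orbit⇒∼ b∈orbit) (∈reps⇒nonzero a∈))

    -- The residues and the concatenated orbits are duplicate-free lists with the same elements,
    -- hence permutations of each other, and each orbit has o entries.
    length-residues : length residues ≡ cosetCount k n * o
    length-residues = begin
      length residues            ≡⟨ ↭-length (unique∧set⇒↭ (Unique.filter⁺ _ (Unique.allFin⁺ n)) orbits-unique residues⊆orbits orbits⊆residues) ⟩
      length (concat orbits)     ≡⟨ length-concat (All.map⁺ (All.tabulate {xs = reps} (λ {a} _ → length-applyUpTo (_^⊙ a) o))) ⟩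
      length orbits * o          ≡⟨ cong (_* o) (length-map orbit reps) ⟩
      cosetCount k n * o         ∎
      where open ≡-Reasoning

  n≡cosetCount*o+1 : n ≡ cosetCount k n * o + 1
  n≡cosetCount*o+1 = begin
    n                                  ≡⟨ suc-pred n ⟨
    suc (pred n)                       ≡⟨ +-comm 1 (pred n) ⟩
    pred n + 1                         ≡⟨ cong (_+ 1) (length-nonzeroResidues (pred n)) ⟨
    length (nonzeroResidues (suc (pred n))) + 1     ≡⟨ cong (λ m → length (nonzeroResidues m) + 1) (suc-pred n) ⟩
    length residues + 1                ≡⟨ cong (_+ 1) length-residues ⟩
    cosetCount k n * o + 1             ∎
    where open ≡-Reasoning

  -- Minimality is `order` taken at d = n: a positive exponent divisible by o is at least o.
  isMultiplicativeOrder : n ≢ 1 → IsMultiplicativeOrder k n o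
  isMultiplicativeOrder n≢1 =
    >-nonZero⁻¹ o , n∣k^o-1 , λ i 1≤i u → ∣⇒≤ {{>-nonZero 1≤i}} (order ∣-refl n≢1 i u)

-- The order of 2 modulo divisors of 2^p + 1, and primitive prime factors.

module _ {p} (prime[p] : Prime p) where

  private instance _ = prime⇒nonZero prime[p]

  2∤2^p+1 : ¬ 2 ∣ 2 ^ p + 1
  2∤2^p+1 2∣ = from-no (2 ∣? 1) (∣m+n∣m⇒∣n 2∣ (2∣2^ p))
    where
    2∣2^ : ∀ n .{{_ : NonZero n}} → 2 ∣ 2 ^ n
    2∣2^ (suc n) = m∣m*n (2 ^ n)

  unitPower⇒2p∣ : ∀ {d} → d ∣ 2 ^ p + 1 → ¬ d ∣ 3 → ∀ i → UnitPower 2 d i → 2 * p ∣ i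
  unitPower⇒2p∣ {d} d∣ d∤3 i u with p ∣? i
  -- The exponents i * 2 and p * 2 with i, p coprime leave the exponent 2, and d ∣ 2^2 - 1 is d ∣ 3.
  ... | no p∤i = contradiction
        (unitPower-coprime 2 d 2 (prime∧∤⇒coprime prime[p] p∤i)
          (subst (UnitPower 2 d) (*-comm 2 i) (unitPower-* 2 d 2 i u))
          (subst (UnitPower 2 d) (p+p≡p*2 p) (∣k^i+1⇒unitPower 2 d p d∣)))
        d∤3
    where
    p+p≡p*2 : ∀ p → p + p ≡ p * 2
    p+p≡p*2 = solve-∀
  ... | yes (divides j refl) with 2 ∣? j
  ...   | yes (divides l refl) = divides l (*-assoc l 2 p)
  ...   | no 2∤j = contradiction d∣2 d∤2
    where
    -- The exponents j * p and 2 * p with j odd leave the exponent p.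
    d∣2^p-1 : UnitPower 2 d p
    d∣2^p-1 = unitPower-coprime 2 d p (prime∧∤⇒coprime prime[2] 2∤j) u
      (subst (UnitPower 2 d) (cong (p +_) (sym (+-identityʳ p))) (∣k^i+1⇒unitPower 2 d p d∣))

    d∣2 : d ∣ 2
    d∣2 = ∣m+n∣m⇒∣n (subst (d ∣_) eq d∣) d∣2^p-1
      where
      open ≡-Reasoning
      eq : 2 ^ p + 1 ≡ ∣ 2 ^ p - 1 ∣ + 2
      eq = begin
        2 ^ p + 1                 ≡⟨ cong (_+ 1) (suc∣n-1∣≡n (2 ^ p) {{m^n≢0 2 p}}) ⟨
        suc ∣ 2 ^ p - 1 ∣ + 1     ≡⟨ +-suc ∣ 2 ^ p - 1 ∣ 1 ⟨
        ∣ 2 ^ p - 1 ∣ + 2         ∎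

    d∤2 : ¬ d ∣ 2
    d∤2 d∣2 with prime⇒irreducible prime[2] d∣2
    ... | inj₁ refl = d∤3 (1∣ 3)
    ... | inj₂ refl = 2∤2^p+1 d∣

  2p∣2m⇒p∣m : ∀ {m} → 2 * p ∣ m + m → p ∣ m
  2p∣2m⇒p∣m {m} 2p∣ = *-cancelˡ-∣ 2 (subst (2 * p ∣_) (cong (m +_) (sym (+-identityʳ m))) 2p∣)

  9∤2^p+1 : p ≢ 3 → ¬ 9 ∣ 2 ^ p + 1
  9∤2^p+1 p≢3 9∣ with prime⇒irreducible (from-yes (prime? 3))
      -- As 2^6 - 1 = 63 is a multiple of 9, 2p divides 6 = 3 + 3, and so p divides 3.
      (2p∣2m⇒p∣m (unitPower⇒2p∣ 9∣ (from-no (9 ∣? 3)) 6 (from-yes (9 ∣? 63))))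
  ... | inj₁ refl = ¬prime[1] prime[p]
  ... | inj₂ p≡3  = p≢3 p≡3

  -- For odd p, 2^p = 2 (x + 1) with x = 4^(p / 2) - 1 a multiple of 3, so 2^p + 1 = 2x + 3.
  3∣2^p+1 : ¬ 2 ∣ p → 3 ∣ 2 ^ p + 1
  3∣2^p+1 2∤p with p % 2 in eq | m%n<n p 2
  ... | 0 | _ = contradiction (m%n≡0⇒n∣m p 2 eq) 2∤p
  ... | 1 | _ = subst (3 ∣_) (sym eq′) (∣m∣n⇒∣m+n (∣n⇒∣m*n 2 3∣) ∣-refl)
    where
    e = (p / 2) * 2
    x = ∣ 2 ^ e - 1 ∣
    3∣ : 3 ∣ x
    3∣ = unitPower-* 2 3 (p / 2) 2 ∣-refl
    open ≡-Reasoning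
    ring : ∀ x → 2 * suc x + 1 ≡ 2 * x + 3
    ring = solve-∀
    eq′ : 2 ^ p + 1 ≡ 2 * x + 3
    eq′ = begin
      2 ^ p + 1           ≡⟨ cong (λ i → 2 ^ i + 1) (m≡m%n+[m/n]*n p 2) ⟩
      2 ^ (p % 2 + e) + 1 ≡⟨ cong (λ i → 2 ^ (i + e) + 1) eq ⟩
      2 * 2 ^ e + 1       ≡⟨ cong (λ y → 2 * y + 1) (suc∣n-1∣≡n (2 ^ e) {{m^n≢0 2 e}}) ⟨
      2 * suc x + 1       ≡⟨ ring x ⟩
      2 * x + 3           ∎
  ... | 2+ _ | s≤s (s≤s ())

  -- If q also divided 2^u + 1, then 2^(2u) ≡ 1 modulo q would give 2p ∣ 2u, hence p ∣ u, impossible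
  -- for 1 ≤ u < p.
  ∣2^p+1⇒primitive : ∀ {q} → Prime q → q ≢ 3 → q ∣ 2 ^ p + 1 → Primitive p 2 1 q
  ∣2^p+1⇒primitive {q} prime[q] q≢3 q∣ = prime[q] , 1^ p q∣ , λ {u} u<p 1≤u q∣2^u+1 →
    let instance _ = >-nonZero 1≤u in
    <⇒≱ u<p (∣⇒≤ (2p∣2m⇒p∣m (unitPower⇒2p∣ q∣ q∤3 (u + u)
      (∣k^i+1⇒unitPower 2 q u (subst (λ y → q ∣ 2 ^ u + y) (^-zeroˡ u) q∣2^u+1)))))
    where
    1^ : ∀ u → q ∣ 2 ^ u + 1 → q ∣ 2 ^ u + 1 ^ u
    1^ u = subst (λ y → q ∣ 2 ^ u + y) (sym (^-zeroˡ u))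

    q∤3 : ¬ q ∣ 3
    q∤3 q∣3 with prime⇒irreducible (from-yes (prime? 3)) q∣3
    ... | inj₁ refl = ¬prime[1] prime[q]
    ... | inj₂ q≡3  = q≢3 q≡3

-- By unique factorisation the prime factors of n are, up to order, q and those of m. The filter
-- drops the former and keeps all the latter. It is applied with q = 3, the one prime factor of 2^p
-- + 1 that is not primitive.
product-filter-factors : ∀ {ℓ} {P : Pred ℕ ℓ} (P? : Decidable P) {q m n} .{{_ : NonZero n}} →
  n ≡ m * q → Prime q → ¬ P q → (∀ {r} → Prime r → r ∣ m → P r) →
  product (filter P? (factors (factorise n))) ≡ m
product-filter-factors P? {q} {zero} {n} n≡mq = contradiction n≡mq (≢-nonZero⁻¹ n)
product-filter-factors {P = P} P? {q} {m@(suc _)} {n} n≡mq prime[q] ¬Pq Pr = begin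
  product (filter P? (factors (factorise n)))  ≡⟨ product-↭ (filter-↭ P? (factorisationUnique (factorise n) q∷f)) ⟩
  product (filter P? (q ∷ factors f))          ≡⟨ cong product (filter-reject P? ¬Pq) ⟩
  product (filter P? (factors f))              ≡⟨ cong product (filter-all P? all-P) ⟩
  product (factors f)                          ≡⟨ isFactorisation f ⟨
  m                                            ∎
  where
  open ≡-Reasoning
  f : PrimeFactorisation m
  f = factorise m

  q∷f : PrimeFactorisation n
  q∷f = record
    { factors         = q ∷ factors f
    ; isFactorisation = trans n≡mq (trans (*-comm m q) (cong (q *_) (isFactorisation f)))
    ; factorsPrime    = prime[q] ∷ factorsPrime f
    }

  all-P : All P (factors f)
  all-P = All.tabulate λ {r} r∈ → Pr (All.lookup (factorsPrime f) r∈)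
    (subst (r ∣_) (sym (isFactorisation f)) (∈⇒∣product r∈))

-- Value and primover property of the Wagstaff number.

proposition11 : ∀ (p : ℕ) → Prime p → ¬ (2 ∣ p) →
    3 ∣ 2 ^ p + 1 ×
    (p ≢ 3 → ζ p 2 1 ≡ (2 ^ p + 1) / 3) ×
    Primover 2 ((2 ^ p + 1) / 3)
proposition11 p prime[p] 2∤p = 3∣ , ζ≡w , primover
  where
  instance _ = prime⇒nonZero prime[p]

  w : ℕ
  w = (2 ^ p + 1) / 3

  3∣ : 3 ∣ 2 ^ p + 1
  3∣ = 3∣2^p+1 prime[p] 2∤p

  w*3≡ : w * 3 ≡ 2 ^ p + 1
  w*3≡ = m/n*n≡m 3∣

  w∣ : w ∣ 2 ^ p + 1
  w∣ = subst (w ∣_) w*3≡ (m∣m*n 3)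

  3∤w : p ≢ 3 → ¬ 3 ∣ w
  3∤w p≢3 3∣w = 9∤2^p+1 prime[p] p≢3 (subst (9 ∣_) w*3≡ (*-monoˡ-∣ 3 3∣w))

  ζ≡w : p ≢ 3 → ζ p 2 1 ≡ w
  ζ≡w p≢3 = product-filter-factors (primitive? p 2 1) {{k^n+h^n≢0 p 2 1}}
    (trans (cong (2 ^ p +_) (^-zeroˡ p)) (sym w*3≡)) (from-yes (prime? 3))
    -- The prime 3 is not primitive: it divides 2^1 + 1^1 = 3 already, and 1 < p.
    (λ (_ , _ , new) → new (nonTrivial⇒n>1 p {{prime⇒nonTrivial prime[p]}}) ≤-refl ∣-refl)
    λ {r} prime[r] r∣w → ∣2^p+1⇒primitive prime[p] prime[r]
      (λ r≡3 → 3∤w p≢3 (subst (_∣ w) r≡3 r∣w)) (∣-trans r∣w w∣)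

  w>1 : 1 < w
  -- Since p ≥ 2, w * 3 exceeds 2^2 = 4.
  w>1 = *-cancelʳ-< 3 1 w (subst (3 <_) (sym w*3≡) (≤-trans (^-monoʳ-≤ 2 2≤p) (m≤m+n (2 ^ p) 1)))
    where
    2≤p : 2 ≤ p
    2≤p = nonTrivial⇒n>1 p {{prime⇒nonTrivial prime[p]}}

  primover : Primover 2 w
  primover with p ≟ 3 | prime? w
  -- Here w = 9 / 3 = 3. It is treated apart because 3 divides w, so the order argument does not
  -- apply.
  ... | yes refl | _           = inj₁ (from-yes (prime? 3))
  ... | no _     | yes prime[w] = inj₁ prime[w]
  ... | no p≢3   | no ¬prime[w] = inj₂
    ( ¬prime⇒composite ¬prime[w]
    , prime∧∤⇒coprime prime[2] (λ 2∣w → 2∤2^p+1 prime[p] (∣-trans 2∣w w∣))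
    , 2 * p , isMultiplicativeOrder (λ w≡1 → <⇒≢ w>1 (sym w≡1)) , n≡cosetCount*o+1)
    where
    instance
      _ = n>1⇒nonTrivial w>1
      _ = nonTrivial⇒nonZero w
      _ = m*n≢0 2 p
    order : ∀ {d} → d ∣ w → d ≢ 1 → ∀ i → UnitPower 2 d i → 2 * p ∣ i
    -- A divisor of 3 is 1 or 3; the first is excluded by assumption, the second because 3 does not
    -- divide w.
    order d∣w d≢1 = unitPower⇒2p∣ prime[p] (∣-trans d∣w w∣)
      ([ d≢1 , (λ { refl → 3∤w p≢3 d∣w }) ] ∘ prime⇒irreducible (from-yes (prime? 3)))

    w∣4^p-1 : UnitPower 2 w (2 * p)
    w∣4^p-1 = subst (UnitPower 2 w) (cong (p +_) (sym (+-identityʳ p))) (∣k^i+1⇒unitPower 2 w p w∣)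

    open CosetsOfEqualOrder 2 w (2 * p) w∣4^p-1 order
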